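{- Let $G^\sigma$ be a connected oriented unicyclic graph of order $n$ with girth $k<n$, and let $C_k^\sigma$ be its cycle. (1) If $G^\sigma\in\mathscr{U}_1$, then $sr(G^\sigma)\leq n$ if $n$ is even and $sr(G^\sigma)\leq n-1$ if $n$ is odd. (2) If $G^\sigma\in\mathscr{U}_2$, then $sr(G^\sigma)\leq n-1$ if $n$ and $k$ are odd; $\leq n-2$ if $n$ is even and $k$ is odd; $\leq n$ if $n$ is even and $C_k^\sigma$ is oddly-oriented; $\leq n-1$ if $n$ is odd and $C_k^\sigma$ is oddly-oriented; $\leq n-2$ if $n$ is even and $C_k^\sigma$ is evenly-oriented; $\leq n-3$ if $n$ is odd and $C_k^\sigma$ is evenly-oriented.
   Context: An oriented graph $G^\sigma$ is a simple graph with an orientation of each edge. Its skew-adjacency matrix $S(G^\sigma)=(s_{ij})$ has $s_{ij}=1$ if there is an arc from $v_i$ to $v_j$, $s_{ij}=-1$ if there is an arc from $v_j$ to $v_i$, and $0$ otherwise; $sr(G^\sigma)$ is its rank. For an even cycle $u_1\cdots u_ku_1$, its sign is the sign of $\prod_{i=1}^k s_{u_iu_{i+1}}$ ($u_{k+1}=u_1$); it is evenly-oriented if the sign is positive, oddly-oriented if negative. A $\delta$-transformation deletes a pendant vertex (a vertex of degree one) together with its unique neighbor and all incident edges. $\mathscr{U}_1$ is the set of oriented unicyclic graphs of order $n$ with girth $k$ that can be transformed into a graph without edges by finitely many $\delta$-transformations; $\mathscr{U}_2$ is the set of those that can be transformed into the oriented cycle $C_k^\sigma$, or the disjoint union of $C_k^\sigma$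 with isolated vertices, by finitely many $\delta$-transformations. -}

module Defs where

open import Level using (0ℓ)
open import Algebra.Bundles using (CommutativeRing)
open import Data.Nat as ℕ using (ℕ; zero; suc; z≤n; s≤s)
open import Data.Nat.DivMod using (_mod_)
open import Data.Nat.Divisibility using () renaming (_∣_ to _∣ℕ_)
import Data.Nat.Properties as ℕ
open import Data.Fin using (Fin; zero; suc; toℕ; punchIn)
open import Data.Fin.Properties using (any?)
open import Data.Fin.Subset using (Subset; _∈_; _∩_; _-_; ⊤; ∣_∣)
open import Data.Product using (Σ; Σ-syntax; ∃; ∃-syntax; ∃₂; _×_; _,_; proj₁; proj₂)
open import Data.Sum using (_⊎_)
open import Data.Rational using (ℚ; 0ℚ; 1ℚ; _+_; _*_; -_; _<_; 1/_; NonZero; ≢-nonZero)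
open import Data.Rational.Properties
  using (_≟_; +-*-commutativeRing; *-inverseˡ; *-zeroˡ; *-zeroʳ; +-identityˡ; *-identityˡ)
open import Data.Rational.Solver using (module +-*-Solver)
open import Data.Vec using (Vec; []; _∷_; lookup; tabulate)
open import Data.Vec.Properties using (lookup∘tabulate)
open import Data.Vec.Functional using (Vector; foldr; insertAt)
open import Data.Vec.Functional.Properties using (insertAt-lookup; insertAt-punchIn)
open import Function using (_∘_; _⇔_; Injective)
open import Relation.Binary using (Rel; Decidable; Asymmetric)
open import Relation.Binary.Construct.Closure.ReflexiveTransitive using (Star)
open import Relation.Binary.PropositionalEquality
open import Relation.Nullary using (Dec; yes; no; does; ¬_; ¬?; contradiction)
open import Relation.Nullary.Decidable using (map′; _×-dec_; _⊎-dec_; decidable-stable)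

open import Algebra.Properties.Semiring.Sum
  (CommutativeRing.semiring +-*-commutativeRing) using (sum; *-distribʳ-sum; sum-cong-≗)
open import Algebra.Properties.CommutativeMonoid.Sum
  (CommutativeRing.+-commutativeMonoid +-*-commutativeRing) using (sum-remove; ∑-distrib-+)

Matrix : ℕ → ℕ → Set
Matrix m n = Fin m → Fin n → ℚ

LinearlyIndependent : ∀ {r d} → (Fin r → Vector ℚ d) → Set
LinearlyIndependent {r} v =
  (c : Fin r → ℚ) → (∀ j → sum (λ i → c i * v i j) ≡ 0ℚ) → ∀ i → c i ≡ 0ℚ

IndependentRows : ∀ {m n} → Matrix m n → ℕ → Set
IndependentRows {m} M r = Σ[ f ∈ (Fin r → Fin m) ] LinearlyIndependent (M ∘ f)

IsRank : ∀ {m n} → Matrix m n → ℕ → Set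
IsRank M r = IndependentRows M r × (∀ s → IndependentRows M s → s ℕ.≤ r)

-- The constructive existence proof for rank decides linear independence by
-- Gaussian elimination on the first coordinate.

private
  1≢0 : ¬ (1ℚ ≡ 0ℚ)
  1≢0 ()

  sum-zero : ∀ {r} (f : Fin r → ℚ) → (∀ i → f i ≡ 0ℚ) → sum f ≡ 0ℚ
  sum-zero {zero}  f h = refl
  sum-zero {suc r} f h = cong₂ _+_ (h zero) (sum-zero (f ∘ suc) (h ∘ suc))

  LI-resp : ∀ {r d} {v w : Fin r → Vector ℚ d} → (∀ i j → v i j ≡ w i j) →
            LinearlyIndependent v → LinearlyIndependent w
  LI-resp eq li c h = li c λ j →
    trans (sum-cong-≗ (λ i → cong (c i *_) (eq i j))) (h j)

  module NoPivot {r d} (v : Fin r → Vector ℚ (suc d)) (z : ∀ i → v i zero ≡ 0ℚ) where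

    fwd : LinearlyIndependent v → LinearlyIndependent (λ i → v i ∘ suc)
    fwd li c h = li c λ where
      zero    → sum-zero _ λ i → trans (cong (c i *_) (z i)) (*-zeroʳ (c i))
      (suc j) → h j

    bwd : LinearlyIndependent (λ i → v i ∘ suc) → LinearlyIndependent v
    bwd li c h = li c (h ∘ suc)

  module Pivot {r d} (v : Fin (suc r) → Vector ℚ (suc d)) (i : Fin (suc r))
               (nz : ¬ (v i zero ≡ 0ℚ)) where

    instance
      p-nz : NonZero (v i zero)
      p-nz = ≢-nonZero nz

    p q : ℚ
    p = v i zero
    q = 1/ p

    qp : q * p ≡ 1ℚ
    qp = *-inverseˡ p

    u : Fin r → Vector ℚ (suc d)
    u = v ∘ punchIn i

    w : Fin r → Vector ℚ d
    w j t = u j (suc t) + u j zero * - (q * v i (suc t))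

    S : (Fin r → ℚ) → Fin (suc d) → ℚ
    S c t = sum (λ j → c j * u j t)

    sum-w : ∀ c t → sum (λ j → c j * w j t) ≡ S c (suc t) + S c zero * - (q * v i (suc t))
    sum-w c t = begin
      sum (λ j → c j * w j t)
        ≡⟨ sum-cong-≗ (λ j → solve 4 (λ a b e f → a :* (b :+ e :* f) := a :* b :+ (a :* e) :* f) refl
             (c j) (u j (suc t)) (u j zero) (- (q * v i (suc t)))) ⟩
      sum (λ j → c j * u j (suc t) + (c j * u j zero) * - (q * v i (suc t)))
        ≡⟨ ∑-distrib-+ (λ j → c j * u j (suc t)) _ ⟩
      S c (suc t) + sum (λ j → (c j * u j zero) * - (q * v i (suc t)))
        ≡⟨ cong (S c (suc t) +_) (sym (*-distribʳ-sum (- (q * v i (suc t))) (λ j → c j * u j zero))) ⟩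
      S c (suc t) + S c zero * - (q * v i (suc t)) ∎
      where open ≡-Reasoning
            open +-*-Solver

    sum-v : ∀ c t → sum (λ j → c j * v j t) ≡ c i * v i t + S (c ∘ punchIn i) t
    sum-v c t = sum-remove {i = i} (λ j → c j * v j t)

    bwd : LinearlyIndependent w → LinearlyIndependent v
    bwd li c h = all-zero
      where
      open ≡-Reasoning
      open +-*-Solver
      c′ = c ∘ punchIn i

      s≡ : ∀ t → S c′ t ≡ - (c i * v i t)
      s≡ t = begin
        S c′ t
          ≡⟨ solve 2 (λ a b → b := (a :+ b) :+ :- a) refl (c i * v i t) (S c′ t) ⟩
        (c i * v i t + S c′ t) + - (c i * v i t)
          ≡⟨ cong (_+ - (c i * v i t)) (trans (sym (sum-v c t)) (h t)) ⟩
        0ℚ + - (c i * v i t)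
          ≡⟨ +-identityˡ _ ⟩
        - (c i * v i t) ∎

      c′-zero : ∀ j → c′ j ≡ 0ℚ
      c′-zero = li c′ λ t → begin
        sum (λ j → c′ j * w j t)
          ≡⟨ sum-w c′ t ⟩
        S c′ (suc t) + S c′ zero * - (q * v i (suc t))
          ≡⟨ cong₂ (λ a b → a + b * - (q * v i (suc t))) (s≡ (suc t)) (s≡ zero) ⟩
        - (c i * v i (suc t)) + - (c i * p) * - (q * v i (suc t))
          ≡⟨ solve 4 (λ a b e f → :- (a :* f) :+ :- (a :* b) :* :- (e :* f)
                                 := (a :* f) :* (e :* b) :+ :- (a :* f)) refl
               (c i) p q (v i (suc t)) ⟩
        (c i * v i (suc t)) * (q * p) + - (c i * v i (suc t))
          ≡⟨ cong (λ x → (c i * v i (suc t)) * x + - (c i * v i (suc t))) qp ⟩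
        (c i * v i (suc t)) * 1ℚ + - (c i * v i (suc t))
          ≡⟨ solve 1 (λ a → a :* con 1ℚ :+ :- a := con 0ℚ) refl (c i * v i (suc t)) ⟩
        0ℚ ∎

      ci-zero : c i ≡ 0ℚ
      ci-zero = begin
        c i                       ≡⟨ solve 1 (λ a → a := a :* con 1ℚ) refl (c i) ⟩
        c i * 1ℚ                  ≡⟨ cong (c i *_) (sym qp) ⟩
        c i * (q * p)             ≡⟨ solve 3 (λ a b e → a :* (e :* b) := :- (:- (a :* b)) :* e) refl (c i) p q ⟩
        - (- (c i * p)) * q       ≡⟨ cong (λ x → - x * q) (sym (s≡ zero)) ⟩
        - (S c′ zero) * q         ≡⟨ cong (λ x → - x * q) (sum-zero _ λ j →
                                       trans (cong (_* u j zero) (c′-zero j)) (*-zeroˡ (u j zero))) ⟩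
        - 0ℚ * q                  ≡⟨ *-zeroˡ q ⟩
        0ℚ ∎

      all-zero : ∀ k → c k ≡ 0ℚ
      all-zero k with i Data.Fin.≟ k
      ... | yes refl = ci-zero
      ... | no i≢k = trans (cong c (sym (Data.Fin.Properties.punchIn-punchOut i≢k)))
                           (c′-zero (Data.Fin.punchOut i≢k))

    fwd : LinearlyIndependent v → LinearlyIndependent w
    fwd li c h j = trans (sym (insertAt-punchIn c i a j)) (li c⁺ h⁺ (punchIn i j))
      where
      open ≡-Reasoning
      open +-*-Solver
      a : ℚ
      a = - (S c zero * q)
      c⁺ : Fin (suc r) → ℚ
      c⁺ = insertAt c i a

      sum⁺ : ∀ t → sum (λ k → c⁺ k * v k t) ≡ a * v i t + S c t
      sum⁺ t = trans (sum-v c⁺ t)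
        (cong₂ _+_ (cong (_* v i t) (insertAt-lookup c i a))
                   (sum-cong-≗ λ k → cong (_* u k t) (insertAt-punchIn c i a k)))

      h⁺ : ∀ t → sum (λ k → c⁺ k * v k t) ≡ 0ℚ
      h⁺ zero = begin
        sum (λ k → c⁺ k * v k zero)    ≡⟨ sum⁺ zero ⟩
        a * p + S c zero               ≡⟨ solve 3 (λ s b e → :- (s :* e) :* b :+ s := :- s :* (e :* b) :+ s)
                                            refl (S c zero) p q ⟩
        - S c zero * (q * p) + S c zero ≡⟨ cong (λ x → - S c zero * x + S c zero) qp ⟩
        - S c zero * 1ℚ + S c zero     ≡⟨ solve 1 (λ s → :- s :* con 1ℚ :+ s := con 0ℚ) refl (S c zero) ⟩
        0ℚ ∎
      h⁺ (suc t) = begin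
        sum (λ k → c⁺ k * v k (suc t))   ≡⟨ sum⁺ (suc t) ⟩
        a * v i (suc t) + S c (suc t)    ≡⟨ solve 4 (λ s e f g → :- (s :* e) :* f :+ g := g :+ s :* :- (e :* f))
                                              refl (S c zero) q (v i (suc t)) (S c (suc t)) ⟩
        S c (suc t) + S c zero * - (q * v i (suc t)) ≡⟨ sym (sum-w c t) ⟩
        sum (λ k → c k * w k t)          ≡⟨ h t ⟩
        0ℚ ∎

  noPivot : ∀ {r d} (v : Fin r → Vector ℚ (suc d)) →
            ¬ (∃ λ i → ¬ (v i zero ≡ 0ℚ)) → ∀ i → v i zero ≡ 0ℚ
  noPivot v ¬piv i = decidable-stable (v i zero ≟ 0ℚ) λ ne → ¬piv (i , ne)

linearlyIndependent? : ∀ {r} d (v : Fin r → Vector ℚ d) → Dec (LinearlyIndependent v)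
linearlyIndependent? {zero}  zero    v = yes λ _ _ ()
linearlyIndependent? {suc r} zero    v = no λ li → 1≢0 (li (λ _ → 1ℚ) (λ ()) zero)
linearlyIndependent?         (suc d) v with any? (λ i → ¬? (v i zero ≟ 0ℚ))
linearlyIndependent?         (suc d) v | no ¬piv =
  map′ bwd fwd (linearlyIndependent? d _)
  where open NoPivot v (noPivot v ¬piv)
linearlyIndependent? {suc r} (suc d) v | yes (i , nz) =
  map′ bwd fwd (linearlyIndependent? d _)
  where open Pivot v i nz

independent⇒≤ : ∀ {r} d (v : Fin r → Vector ℚ d) → LinearlyIndependent v → r ℕ.≤ d
independent⇒≤ {zero}  zero    v li = z≤n
independent⇒≤ {suc r} zero    v li = contradiction (li (λ _ → 1ℚ) (λ ()) zero) 1≢0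
independent⇒≤         (suc d) v li with any? (λ i → ¬? (v i zero ≟ 0ℚ))
independent⇒≤         (suc d) v li | no ¬piv =
  ℕ.m≤n⇒m≤1+n (independent⇒≤ d _ (NoPivot.fwd v (noPivot v ¬piv) li))
independent⇒≤ {suc r} (suc d) v li | yes (i , nz) =
  s≤s (independent⇒≤ d _ (Pivot.fwd v i nz li))

private
  anyVec? : ∀ {m r} {P : Vec (Fin m) r → Set} → (∀ xs → Dec (P xs)) → Dec (∃ P)
  anyVec? {r = zero}  P? = map′ ([] ,_) (λ { ([] , p) → p }) (P? [])
  anyVec? {r = suc r} P? =
    map′ (λ { (x , xs , p) → x ∷ xs , p }) (λ { (x ∷ xs , p) → x , xs , p })
         (any? λ x → anyVec? λ xs → P? (x ∷ xs))

  greatest : {P : ℕ → Set} → (∀ r → Dec (P r)) → P 0 →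
             ∀ b → (∀ r → P r → r ℕ.≤ b) → ∃[ r ] P r × (∀ s → P s → s ℕ.≤ r)
  greatest P? p₀ zero    bnd = 0 , p₀ , bnd
  greatest P? p₀ (suc b) bnd with P? (suc b)
  ... | yes p = suc b , p , bnd
  ... | no ¬p = greatest P? p₀ b λ r pr →
    ℕ.≤-pred (ℕ.≤∧≢⇒< (bnd r pr) λ { refl → ¬p pr })

independentRows? : ∀ {m n} (M : Matrix m n) r → Dec (IndependentRows M r)
independentRows? M r =
  map′ (λ (xs , li) → lookup xs , li)
       (λ (f , li) → tabulate f ,
          LI-resp (λ i j → cong (λ x → M x j) (sym (lookup∘tabulate f i))) li)
       (anyVec? λ xs → linearlyIndependent? _ (M ∘ lookup xs))

rank-exists : ∀ {m n} (M : Matrix m n) → ∃ (IsRank M)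
rank-exists {n = n} M =
  greatest (independentRows? M) ((λ ()) , λ _ _ ()) n
           (λ r (f , li) → independent⇒≤ n (M ∘ f) li)

rank : ∀ {m n} → Matrix m n → ℕ
rank M = proj₁ (rank-exists M)

rank-isRank : ∀ {m n} (M : Matrix m n) → IsRank M (rank M)
rank-isRank M = proj₂ (rank-exists M)

-- Asymmetry excludes loops as well as pairs of opposite arcs, so the
-- underlying graph is simple.
record OrientedGraph (n : ℕ) : Set₁ where
  infix 4 _⟶_ _⟶?_
  field
    _⟶_  : Rel (Fin n) 0ℓ
    _⟶?_ : Decidable _⟶_
    asym : Asymmetric _⟶_

module _ {n : ℕ} (G : OrientedGraph n) where
  open OrientedGraph G

  Adjacent : Rel (Fin n) 0ℓ
  Adjacent u v = u ⟶ v ⊎ v ⟶ u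

  adjacent? : Decidable Adjacent
  adjacent? u v = (u ⟶? v) ⊎-dec (v ⟶? u)

  skewEntry : ∀ {u v} → Dec (u ⟶ v) → Dec (v ⟶ u) → ℚ
  skewEntry (yes _) _       = 1ℚ
  skewEntry (no _)  (yes _) = - 1ℚ
  skewEntry (no _)  (no _)  = 0ℚ

  skewAdjacency : Matrix n n
  skewAdjacency u v = skewEntry (u ⟶? v) (v ⟶? u)

  -- The entries are rational, so this is also the rank over ℝ.
  sr : ℕ
  sr = rank skewAdjacency

  Connected : Set
  Connected = ∀ u v → Star Adjacent u v

-- i ↦ i + 1 modulo k
next : ∀ {k} → Fin k → Fin k
next {suc k} i = suc (toℕ i) mod suc k

record Cycle {n : ℕ} (G : OrientedGraph n) (k : ℕ) : Set where
  field
    3≤k       : 3 ℕ.≤ k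
    vertex    : Fin k → Fin n
    injective : Injective _≡_ _≡_ vertex
    adjacent  : ∀ i → Adjacent G (vertex i) (vertex (next i))

module _ {n : ℕ} {G : OrientedGraph n} where
  open Cycle

  CycleEdge : ∀ {k} → Cycle G k → Rel (Fin n) 0ℓ
  CycleEdge C u v = ∃[ i ] (u ≡ vertex C i × v ≡ vertex C (next i)
                          ⊎ v ≡ vertex C i × u ≡ vertex C (next i))

  -- Equality as subgraphs: a cycle does not depend on the starting point or
  -- the direction of its enumeration.
  SameCycle : ∀ {k l} → Cycle G k → Cycle G l → Set
  SameCycle C D = ∀ u v → CycleEdge C u v ⇔ CycleEdge D u v

  cycleSign : ∀ {k} → Cycle G k → ℚ
  cycleSign C = foldr _*_ 1ℚ λ i → skewAdjacency G (vertex C i) (vertex C (next i))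

  EvenlyOriented OddlyOriented : ∀ {k} → Cycle G k → Set
  EvenlyOriented {k} C = 2 ∣ℕ k × 0ℚ < cycleSign C
  OddlyOriented  {k} C = 2 ∣ℕ k × cycleSign C < 0ℚ

module _ {n : ℕ} (G : OrientedGraph n) where

  Unicyclic : Set
  Unicyclic = ∃[ k ] Σ[ C ∈ Cycle G k ] (∀ {l} (D : Cycle G l) → SameCycle D C)

  HasGirth : ℕ → Set
  HasGirth k = Cycle G k × (∀ {l} → Cycle G l → k ℕ.≤ l)

  -- Graphs obtained by deleting vertices are represented by the set T of
  -- remaining vertices, standing for the subgraph of G induced on T.

  degree : Subset n → Fin n → ℕ
  degree T u = ∣ T ∩ tabulate (λ v → does (adjacent? G u v)) ∣

  δ : Rel (Subset n) 0ℓ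
  δ T T′ = ∃₂ λ u v → u ∈ T × degree T u ≡ 1 × v ∈ T × Adjacent G u v × T′ ≡ T - u - v

  Edgeless : Subset n → Set
  Edgeless T = ∀ {u v} → u ∈ T → v ∈ T → ¬ Adjacent G u v

  CycleWithIsolatedVertices : ∀ {k} → Cycle G k → Subset n → Set
  CycleWithIsolatedVertices C T =
    (∀ i → Cycle.vertex C i ∈ T) ×
    (∀ {u v} → u ∈ T → v ∈ T → Adjacent G u v → CycleEdge C u v)

  𝒰₁ : ℕ → Set
  𝒰₁ k = Unicyclic × HasGirth k × ∃[ T ] Star δ ⊤ T × Edgeless T

  𝒰₂ : ∀ {k} → Cycle G k → Set
  𝒰₂ {k} C = Unicyclic × HasGirth k × ∃[ T ] Star δ ⊤ T × CycleWithIsolatedVertices C T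

{-# OPTIONS --safe #-}

-- The rank is at most n − d as soon as S has d independent null vectors. Each
-- δ-transformation can be undone on null vectors, so it suffices to find them on
-- the final graph T: every isolated vertex contributes its unit vector, an odd
-- cycle one vector, and an evenly-oriented cycle two. As |T| ≡ n (mod 2), T
-- has an isolated vertex unless |T| is the number of vertices on its cycle.

module Submission where

open import Defs
open import Data.Nat using (ℕ; _<_; _≤_; _∸_)
open import Data.Nat.Divisibility using (_∣_; _∤_)
open import Data.Product using (_×_)

open import Algebra.Bundles using (CommutativeRing)
open import Data.Bool using (if_then_else_)
open import Data.Fin using (Fin; zero; suc; toℕ; splitAt; _↑ˡ_; _↑ʳ_; _≟_)
open import Data.Fin.Properties
  using (any?; toℕ-fromℕ<; toℕ-injective; toℕ<n; fromℕ<-cong; splitAt⁻¹-↑ˡ; splitAt⁻¹-↑ʳ; suc-injective)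
open import Data.Fin.Subset using (Subset; _∈_; _∉_; _∩_; _-_; ∣_∣; ⊤; inside; outside)
open import Data.Fin.Subset.Properties
  using (_∈?_; ∈⊤; ∣⊤∣≡n; ∣⊥∣≡0; p─⊥≡p; p─q⊆p; x∈p∧x≢y⇒x∈p-y; x∈p∩q⁺; Empty-unique)
open import Data.Nat as ℕ using (zero; suc; s≤s)
open import Data.Nat.DivMod
  using (_mod_; _%_; _/_; m≡m%n+[m/n]*n; m%n<n; m<n⇒m%n≡m; [m+n]%n≡m%n)
open import Data.Nat.Divisibility using (divides; ∣-refl; ∣m∣n⇒∣m+n; ∣m+n∣m⇒∣n; _∣0)
import Data.Nat.Properties as ℕ
open import Data.Product using (Σ-syntax; ∃; _,_; proj₁; proj₂)
open import Data.Rational as ℚ using (ℚ; 0ℚ; 1ℚ; _+_; _*_; -_)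
open import Data.Rational.Properties as ℚ
  using (+-*-commutativeRing; *-zeroˡ; *-zeroʳ; *-identityˡ; *-identityʳ; *-comm; *-assoc; +-identityˡ; +-identityʳ)
open import Data.Rational.Solver using (module +-*-Solver)
open import Data.Sum using (_⊎_; inj₁; inj₂)
open import Data.Vec using (_∷_; here; there; tabulate)
open import Data.Vec.Properties using (lookup∘tabulate; lookup⇒[]=)
open import Data.Vec.Functional using (Vector; foldr; _++_) renaming (_∷_ to _∷ᶠ_)
open import Data.Vec.Functional.Properties using (lookup-++ˡ; lookup-++ʳ)
open import Function using (_∘_; id; _⇔_; mk⇔; Injective; Equivalence)
open import Relation.Binary.Construct.Closure.ReflexiveTransitive using (Star; ε; _◅_)
open import Relation.Binary.PropositionalEquality
open import Relation.Nullary using (Dec; yes; no; does; ¬_; ¬?; contradiction)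
open import Relation.Nullary.Decidable using (_×-dec_; dec-true)

open import Algebra.Properties.Semiring.Sum (CommutativeRing.semiring +-*-commutativeRing)
  using (sum; *-distribˡ-sum; *-distribʳ-sum; sum-cong-≗; sum-replicate-zero)
open import Algebra.Properties.CommutativeMonoid.Sum (CommutativeRing.+-commutativeMonoid +-*-commutativeRing)
  using (∑-distrib-+; ∑-comm)

open ≡-Reasoning
open +-*-Solver using (solve; con; _:=_; _:+_; _:*_; :-_)

-- Finite sums and unit vectors

sum-zero : ∀ {r} (f : Vector ℚ r) → (∀ i → f i ≡ 0ℚ) → sum f ≡ 0ℚ
sum-zero {r} f f≡0 = trans (sum-cong-≗ f≡0) (sum-replicate-zero r)

sum-split : ∀ m {n} (f : Vector ℚ (m ℕ.+ n)) →
            sum f ≡ sum (λ i → f (i ↑ˡ n)) + sum (λ i → f (m ↑ʳ i))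
sum-split zero    f = sym (+-identityˡ _)
sum-split (suc m) {n} f = trans (cong (f zero +_) (sum-split m (f ∘ suc)))
  (solve 3 (λ a b c → a :+ (b :+ c) := (a :+ b) :+ c) refl (f zero) (sum (λ i → f (suc (i ↑ˡ n)))) _)

-- The two summations are exchanged. With `g` a column of a matrix, this lets the matrix act on each
-- vector of a linear combination separately.
sum-combination : ∀ {r m} (c : Vector ℚ r) (V : Fin r → Vector ℚ m) (g : Vector ℚ m) →
  sum (λ t → sum (λ i → c i * V i t) * g t) ≡ sum (λ i → c i * sum (λ t → V i t * g t))
sum-combination c V g = begin
  sum (λ t → sum (λ i → c i * V i t) * g t)
    ≡⟨ sum-cong-≗ (λ t → *-distribʳ-sum (g t) (λ i → c i * V i t)) ⟩
  sum (λ t → sum (λ i → c i * V i t * g t))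
    ≡⟨ ∑-comm (λ t i → c i * V i t * g t) ⟩
  sum (λ i → sum (λ t → c i * V i t * g t))
    ≡⟨ sum-cong-≗ (λ i → trans (sum-cong-≗ λ t → *-assoc (c i) (V i t) (g t))
                               (sym (*-distribˡ-sum (c i) (λ t → V i t * g t)))) ⟩
  sum (λ i → c i * sum (λ t → V i t * g t)) ∎

unit : ∀ {n} → Fin n → Vector ℚ n
unit w t = if does (w ≟ t) then 1ℚ else 0ℚ

unit-self : ∀ {n} (w : Fin n) → unit w w ≡ 1ℚ
unit-self w = cong (if_then 1ℚ else 0ℚ) (dec-true (w ≟ w) refl)

unit-≢ : ∀ {n} {w t : Fin n} → w ≢ t → unit w t ≡ 0ℚ
unit-≢ {w = w} {t} w≢t with w ≟ t
... | yes w≡t = contradiction w≡t w≢t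
... | no  _   = refl

sum-unit : ∀ {n} (w : Fin n) (g : Vector ℚ n) → sum (λ t → unit w t * g t) ≡ g w
sum-unit zero g = begin
  1ℚ * g zero + sum (λ t → 0ℚ * g (suc t))
    ≡⟨ cong₂ _+_ (*-identityˡ (g zero)) (sum-zero _ λ t → *-zeroˡ (g (suc t))) ⟩
  g zero + 0ℚ
    ≡⟨ +-identityʳ (g zero) ⟩
  g zero ∎
sum-unit (suc w) g = begin
  0ℚ * g zero + sum (λ t → unit w t * g (suc t))
    ≡⟨ cong₂ _+_ (*-zeroˡ (g zero)) (sum-unit w (g ∘ suc)) ⟩
  0ℚ + g (suc w)
    ≡⟨ +-identityˡ (g (suc w)) ⟩
  g (suc w) ∎

-- `f` is the sum of its restrictions to `a` and `b`, and `sum-unit` evaluates each of them. Used to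
-- reduce the equation at a cycle vertex to its two neighbours.
sum-pair : ∀ {n} {a b : Fin n} → a ≢ b → (f : Vector ℚ n) →
           (∀ t → t ≢ a → t ≢ b → f t ≡ 0ℚ) → sum f ≡ f a + f b
sum-pair {a = a} {b} a≢b f f≡0 = begin
  sum f                                        ≡⟨ sum-cong-≗ split ⟩
  sum (λ t → unit a t * f t + unit b t * f t)  ≡⟨ ∑-distrib-+ (λ t → unit a t * f t) _ ⟩
  sum (λ t → unit a t * f t) + sum (λ t → unit b t * f t)
    ≡⟨ cong₂ _+_ (sum-unit a f) (sum-unit b f) ⟩
  f a + f b                                    ∎
  where
  split : ∀ t → f t ≡ unit a t * f t + unit b t * f t
  split t with a ≟ t | b ≟ t
  ... | yes refl | yes refl = contradiction refl a≢b
  ... | yes refl | no _     = solve 1 (λ x → x := con 1ℚ :* x :+ con 0ℚ :* x) refl (f t)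
  ... | no _     | yes refl = solve 1 (λ x → x := con 0ℚ :* x :+ con 1ℚ :* x) refl (f t)
  ... | no a≢t   | no b≢t   = trans (f≡0 t (a≢t ∘ sym) (b≢t ∘ sym))
    (sym (solve 1 (λ x → con 0ℚ :* x :+ con 0ℚ :* x := con 0ℚ) refl (f t)))

-- Linear independence and the rank bound

nonzero-cancelʳ : ∀ {x y} → y ≢ 0ℚ → x * y ≡ 0ℚ → x ≡ 0ℚ
nonzero-cancelʳ {x} {y} y≢0 xy≡0 = begin
  x                          ≡⟨ *-identityʳ x ⟨
  x * 1ℚ                     ≡⟨ cong (x *_) (ℚ.*-inverseʳ y) ⟨
  x * (y * ℚ.1/ y)           ≡⟨ *-assoc x y _ ⟨
  (x * y) * ℚ.1/ y           ≡⟨ cong (_* ℚ.1/ y) xy≡0 ⟩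
  0ℚ * ℚ.1/ y                ≡⟨ *-zeroˡ (ℚ.1/ y) ⟩
  0ℚ                         ∎
  where
  instance y-nz = ℚ.≢-nonZero y≢0

-- Coordinate `p` of a vanishing combination sees only `x`, so the coefficient of `x` is zero and
-- what remains is a relation among `X`.
independent-∷ : ∀ {r d} (x : Vector ℚ d) (X : Fin r → Vector ℚ d) (p : Fin d) →
                x p ≢ 0ℚ → (∀ i → X i p ≡ 0ℚ) →
                LinearlyIndependent X → LinearlyIndependent (x ∷ᶠ X)
independent-∷ x X p xp≢0 Xp≡0 li c h = λ where
    zero    → c₀≡0
    (suc i) → li (c ∘ suc) tail≡0 i
  where
  c₀≡0 : c zero ≡ 0ℚ
  c₀≡0 = nonzero-cancelʳ xp≢0 (begin
    c zero * x p       ≡⟨ +-identityʳ _ ⟨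
    c zero * x p + 0ℚ  ≡⟨ cong (c zero * x p +_) (sum-zero (λ i → c (suc i) * X i p) λ i →
                            trans (cong (c (suc i) *_) (Xp≡0 i)) (*-zeroʳ (c (suc i)))) ⟨
    c zero * x p + sum (λ i → c (suc i) * X i p)  ≡⟨ h p ⟩
    0ℚ                 ∎)

  tail≡0 : ∀ t → sum (λ i → c (suc i) * X i t) ≡ 0ℚ
  tail≡0 t = begin
    sum (λ i → c (suc i) * X i t)          ≡⟨ +-identityˡ _ ⟨
    0ℚ + sum (λ i → c (suc i) * X i t)     ≡⟨ cong (_+ sum (λ i → c (suc i) * X i t)) (*-zeroˡ (x t)) ⟨
    0ℚ * x t + sum (λ i → c (suc i) * X i t)
      ≡⟨ cong (λ a → a * x t + sum (λ i → c (suc i) * X i t)) c₀≡0 ⟨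
    c zero * x t + sum (λ i → c (suc i) * X i t) ≡⟨ h t ⟩
    0ℚ                                     ∎

module _ {m n : ℕ} (M : Matrix m n) where

  LeftNull : Vector ℚ m → Set
  LeftNull x = ∀ t → sum (λ i → x i * M i t) ≡ 0ℚ

  -- Unit vectors at the indices of independent rows, together with
  -- independent left null vectors, are independent: apply M.
  independentRows+leftNull≤ : ∀ {r d} → IndependentRows M r →
    (X : Fin d → Vector ℚ m) → (∀ j → LeftNull (X j)) → LinearlyIndependent X → d ℕ.+ r ≤ m
  independentRows+leftNull≤ {r} {d} (f , rows) X null li = independent⇒≤ m V li-V
    where
    V : Fin (d ℕ.+ r) → Vector ℚ m
    V = X ++ (unit ∘ f)

    li-V : LinearlyIndependent V
    li-V c h = c≡0
      where
      a : Vector ℚ d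
      a j = c (j ↑ˡ r)
      b : Vector ℚ r
      b i = c (d ↑ʳ i)

      sum-V : ∀ t → sum (λ i → a i * X i t) + sum (λ i → b i * unit (f i) t) ≡ 0ℚ
      sum-V t = begin
        sum (λ i → a i * X i t) + sum (λ i → b i * unit (f i) t)
          ≡⟨ cong₂ _+_ (sum-cong-≗ λ i → cong (λ v → a i * v t) (lookup-++ˡ X (unit ∘ f) i))
                       (sum-cong-≗ λ i → cong (λ v → b i * v t) (lookup-++ʳ X (unit ∘ f) i)) ⟨
        sum (λ i → a i * V (i ↑ˡ r) t) + sum (λ i → b i * V (d ↑ʳ i) t)
          ≡⟨ sum-split d (λ i → c i * V i t) ⟨
        sum (λ i → c i * V i t)
          ≡⟨ h t ⟩
        0ℚ ∎

      b≡0 : ∀ i → b i ≡ 0ℚ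
      -- Paired with column `s` of `M`, the null vectors drop out and `unit (f i)` gives the entry
      -- of row `f i`, so `b` is a relation among the independent rows.
      b≡0 = rows b λ s → begin
        sum (λ i → b i * M (f i) s)
          ≡⟨ sum-cong-≗ (λ i → cong (b i *_) (sum-unit (f i) (λ t → M t s))) ⟨
        sum (λ i → b i * sum (λ t → unit (f i) t * M t s))
          ≡⟨ +-identityˡ _ ⟨
        0ℚ + sum (λ i → b i * sum (λ t → unit (f i) t * M t s))
          ≡⟨ cong (_+ sum (λ i → b i * sum (λ t → unit (f i) t * M t s)))
               (sum-zero _ λ i → trans (cong (a i *_) (null i s)) (*-zeroʳ (a i))) ⟨
        sum (λ i → a i * sum (λ t → X i t * M t s)) + sum (λ i → b i * sum (λ t → unit (f i) t * M t s))
          ≡⟨ cong₂ _+_ (sum-combination a X (λ t → M t s)) (sum-combination b (unit ∘ f) (λ t → M t s)) ⟨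
        sum (λ t → A t * M t s) + sum (λ t → B t * M t s)
          ≡⟨ ∑-distrib-+ (λ t → A t * M t s) _ ⟨
        sum (λ t → A t * M t s + B t * M t s)
          ≡⟨ sum-zero _ (λ t → trans (sym (ℚ.*-distribʳ-+ (M t s) (A t) (B t)))
                (trans (cong (_* M t s) (sum-V t)) (*-zeroˡ (M t s)))) ⟩
        0ℚ ∎
        where
        A B : Vector ℚ m
        A t = sum (λ i → a i * X i t)
        B t = sum (λ i → b i * unit (f i) t)

      a≡0 : ∀ j → a j ≡ 0ℚ
      a≡0 = li a λ t → begin
        sum (λ i → a i * X i t)       ≡⟨ +-identityʳ _ ⟨
        sum (λ i → a i * X i t) + 0ℚ
          ≡⟨ cong (sum (λ i → a i * X i t) +_) (sum-zero _ λ i →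
               trans (cong (_* unit (f i) t) (b≡0 i)) (*-zeroˡ (unit (f i) t))) ⟨
        sum (λ i → a i * X i t) + sum (λ i → b i * unit (f i) t) ≡⟨ sum-V t ⟩
        0ℚ ∎

      c≡0 : ∀ k → c k ≡ 0ℚ
      c≡0 k with splitAt d k in eq
      ... | inj₁ j = trans (cong c (sym (splitAt⁻¹-↑ˡ eq))) (a≡0 j)
      ... | inj₂ i = trans (cong c (sym (splitAt⁻¹-↑ʳ eq))) (b≡0 i)

  rank+leftNull≤ : ∀ {d} (X : Fin d → Vector ℚ m) → (∀ j → LeftNull (X j)) →
                   LinearlyIndependent X → rank M ≤ m ∸ d
  rank+leftNull≤ {d} X null li = ℕ.m+n≤o⇒m≤o∸n (rank M)
    (subst (_≤ m) (ℕ.+-comm d (rank M))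
      (independentRows+leftNull≤ (proj₁ (rank-isRank M)) X null li))

-- Cardinalities of subsets

∣p∣≡1+∣p-x∣ : ∀ {n} {p : Subset n} {x} → x ∈ p → ∣ p ∣ ≡ suc ∣ p - x ∣
∣p∣≡1+∣p-x∣ {p = _ ∷ p} here = cong (suc ∘ ∣_∣) (sym (p─⊥≡p p))
∣p∣≡1+∣p-x∣ {p = inside  ∷ _} (there x∈p) = cong suc (∣p∣≡1+∣p-x∣ x∈p)
∣p∣≡1+∣p-x∣ {p = outside ∷ _} (there x∈p) = ∣p∣≡1+∣p-x∣ x∈p

p-x⊆p : ∀ {n} (p : Subset n) x {y} → y ∈ p - x → y ∈ p
p-x⊆p p x = p─q⊆p p _

x∉p-x : ∀ {n} (p : Subset n) x → x ∉ p - x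
x∉p-x (_ ∷ _) zero    ()
x∉p-x (_ ∷ p) (suc x) (there x∈) = x∉p-x p x x∈

∣p∣≡1⇒unique : ∀ {n} {p : Subset n} {x y} → ∣ p ∣ ≡ 1 → x ∈ p → y ∈ p → x ≡ y
∣p∣≡1⇒unique {p = p} {x} {y} ∣p∣≡1 x∈p y∈p with x ≟ y
... | yes x≡y = x≡y
... | no  x≢y = contradiction
  (trans (sym ∣p∣≡1) (trans (∣p∣≡1+∣p-x∣ x∈p)
    (cong suc (∣p∣≡1+∣p-x∣ (x∈p∧x≢y⇒x∈p-y y∈p (x≢y ∘ sym))))))
  λ ()

∣image∣ : ∀ {n m} (p : Subset n) (f : Fin m → Fin n) → Injective _≡_ _≡_ f →
          (∀ i → f i ∈ p) → (∀ {x} → x ∈ p → ∃ λ i → f i ≡ x) → ∣ p ∣ ≡ m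
∣image∣ {n} {zero} p f inj f∈p onto =
  trans (cong ∣_∣ (Empty-unique λ (x , x∈p) → contradiction (proj₁ (onto x∈p)) λ ())) (∣⊥∣≡0 n)
∣image∣ {n} {suc m} p f inj f∈p onto = trans (∣p∣≡1+∣p-x∣ (f∈p zero))
  (cong suc (∣image∣ (p - f zero) (f ∘ suc) (suc-injective ∘ inj) f∈p-f₀ onto-p-f₀))
  where
  f∈p-f₀ : ∀ i → f (suc i) ∈ p - f zero
  f∈p-f₀ i = x∈p∧x≢y⇒x∈p-y (f∈p (suc i)) λ eq → contradiction (inj eq) λ ()

  onto-p-f₀ : ∀ {x} → x ∈ p - f zero → ∃ λ i → f (suc i) ≡ x
  onto-p-f₀ x∈ with onto (p-x⊆p p (f zero) x∈)
  ... | zero  , refl = contradiction x∈ (x∉p-x p (f zero))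
  ... | suc i , eq   = i , eq

-- The source of isolated vertices: `f` will enumerate the cycle, or be empty when the final graph
-- is edgeless. If nothing were missed, `f` would be a bijection onto `p`.
missed : ∀ {n m} (p : Subset n) (f : Fin m → Fin n) → Injective _≡_ _≡_ f →
         (∀ i → f i ∈ p) → ∣ p ∣ ≢ m → ∃ λ w → w ∈ p × (∀ i → f i ≢ w)
missed p f inj f∈p ∣p∣≢m with any? (λ w → (w ∈? p) ×-dec ¬? (any? λ i → f i ≟ w))
... | yes (w , w∈p , w∉f) = w , w∈p , λ i eq → w∉f (i , eq)
... | no  ¬missed = contradiction (∣image∣ p f inj f∈p onto) ∣p∣≢m
  where
  onto : ∀ {x} → x ∈ p → ∃ λ i → f i ≡ x
  onto {x} x∈p with any? (λ i → f i ≟ x)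
  ... | yes hit = hit
  ... | no ¬hit = contradiction (x , x∈p , ¬hit) ¬missed

-- Signs, matrix entries and adjacency

IsSign : ℚ → Set
IsSign x = x ≡ 1ℚ ⊎ x ≡ - 1ℚ

sign-* : ∀ {x y} → IsSign x → IsSign y → IsSign (x * y)
sign-* (inj₁ refl) (inj₁ refl) = inj₁ refl
sign-* (inj₁ refl) (inj₂ refl) = inj₂ refl
sign-* (inj₂ refl) (inj₁ refl) = inj₂ refl
sign-* (inj₂ refl) (inj₂ refl) = inj₁ refl

sign² : ∀ {x} → IsSign x → x * x ≡ 1ℚ
sign² (inj₁ refl) = refl
sign² (inj₂ refl) = refl

sign-≢0 : ∀ {x} → IsSign x → x ≢ 0ℚ
sign-≢0 (inj₁ refl) ()
sign-≢0 (inj₂ refl) ()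

sign-positive : ∀ {x} → IsSign x → 0ℚ ℚ.< x → x ≡ 1ℚ
sign-positive (inj₁ x≡1) _ = x≡1
sign-positive (inj₂ refl) (ℚ.*<* ())

module _ {n : ℕ} (G : OrientedGraph n) where
  open OrientedGraph G

  private
    M : Matrix n n
    M = skewAdjacency G

  nonadjacent⇒0 : ∀ {u v} → ¬ Adjacent G u v → M u v ≡ 0ℚ
  nonadjacent⇒0 {u} {v} ¬adj with u ⟶? v | v ⟶? u
  ... | yes u⟶v | _       = contradiction (inj₁ u⟶v) ¬adj
  ... | no  _   | yes v⟶u = contradiction (inj₂ v⟶u) ¬adj
  ... | no  _   | no  _   = refl

  adjacent⇒sign : ∀ {u v} → Adjacent G u v → IsSign (M u v)
  adjacent⇒sign {u} {v} adj with u ⟶? v | v ⟶? u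
  ... | yes _    | _        = inj₁ refl
  ... | no _     | yes _    = inj₂ refl
  ... | no ¬u⟶v  | no ¬v⟶u  with adj
  ...   | inj₁ u⟶v = contradiction u⟶v ¬u⟶v
  ...   | inj₂ v⟶u = contradiction v⟶u ¬v⟶u

  skew : ∀ u v → M v u ≡ - M u v
  skew u v with u ⟶? v | v ⟶? u
  ... | yes u⟶v | yes v⟶u = contradiction v⟶u (asym u⟶v)
  ... | yes _   | no _    = refl
  ... | no _    | yes _   = refl
  ... | no _    | no _    = refl

  ¬self-adjacent : ∀ {u} → ¬ Adjacent G u u
  ¬self-adjacent (inj₁ u⟶u) = asym u⟶u u⟶u
  ¬self-adjacent (inj₂ u⟶u) = asym u⟶u u⟶u

  adjacent-sym : ∀ {u v} → Adjacent G u v → Adjacent G v u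
  adjacent-sym (inj₁ u⟶v) = inj₂ u⟶v
  adjacent-sym (inj₂ v⟶u) = inj₁ v⟶u

  pendant-neighbour : ∀ {T u v w} → degree G T u ≡ 1 →
    v ∈ T → Adjacent G u v → w ∈ T → Adjacent G u w → w ≡ v
  pendant-neighbour {T} {u} deg v∈T uv w∈T uw =
    ∣p∣≡1⇒unique deg (neighbour w∈T uw) (neighbour v∈T uv)
    where
    neighbour : ∀ {w} → w ∈ T → Adjacent G u w →
                w ∈ T ∩ tabulate (λ v → does (adjacent? G u v))
    neighbour {w} w∈T uw = x∈p∩q⁺ (w∈T , lookup⇒[]= w _
      (trans (lookup∘tabulate _ w) (dec-true (adjacent? G u w) uw)))

  -- Effect of δ-transformations on parity and on null vectors

  δ-size : ∀ {T T′} → δ G T T′ → ∣ T ∣ ≡ 2 ℕ.+ ∣ T′ ∣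
  δ-size {T} (u , v , u∈T , _ , v∈T , uv , refl) =
    trans (∣p∣≡1+∣p-x∣ u∈T) (cong suc (∣p∣≡1+∣p-x∣ (x∈p∧x≢y⇒x∈p-y v∈T
      -- No vertex is adjacent to itself, so `v` survives the deletion of `u`.
      λ { refl → ¬self-adjacent uv })))

  -- Each step removes exactly two vertices.
  δ*-even : ∀ {T T′} → Star (δ G) T T′ → (2 ∣ ∣ T ∣) ⇔ (2 ∣ ∣ T′ ∣)
  δ*-even ε = mk⇔ id id
  δ*-even {T} {T′} (step ◅ steps) = mk⇔
    (λ e → Equivalence.to IH (∣m+n∣m⇒∣n (subst (2 ∣_) (δ-size step) e) ∣-refl))
    (λ e → subst (2 ∣_) (sym (δ-size step)) (∣m∣n⇒∣m+n ∣-refl (Equivalence.from IH e)))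
    where IH = δ*-even steps

  -- A null vector of the subgraph induced on `T`, padded with zeros to length `n`. Vectors for
  -- different `T` thus live in one space and share the matrix `M`.
  record NullOn (T : Subset n) (x : Vector ℚ n) : Set where
    field
      support : ∀ {i} → i ∉ T → x i ≡ 0ℚ
      null    : ∀ {t} → t ∈ T → sum (λ i → x i * M i t) ≡ 0ℚ
  open NullOn

  record NullFamily (T : Subset n) (d : ℕ) : Set where
    field
      family      : Fin d → Vector ℚ n
      nullOn      : ∀ j → NullOn T (family j)
      independent : LinearlyIndependent family
  open NullFamily

  -- A null vector off a pendant vertex u and its neighbour v extends by 0 at v,
  -- the value at u being determined by the equation of v.
  module _ {T : Subset n} {u v : Fin n} (u∈T : u ∈ T) (deg : degree G T u ≡ 1)
           (v∈T : v ∈ T) (uv : Adjacent G u v) where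
    private
      T′ : Subset n
      T′ = T - u - v

      -- Solves the equation at `v` for the value at `u`. Multiplying by `M u v` does the work of
      -- dividing by it, since it is a sign.
      a : Vector ℚ n → ℚ
      a x = - (sum (λ i → x i * M i v) * M u v)

      T′⊆T : ∀ {i} → i ∈ T′ → i ∈ T
      T′⊆T i∈T′ = p-x⊆p T u (p-x⊆p (T - u) v i∈T′)

      v∉T′ : v ∉ T′
      v∉T′ = x∉p-x (T - u) v

      u∉T′ : u ∉ T′
      u∉T′ u∈T′ = x∉p-x T u (p-x⊆p (T - u) v u∈T′)

      uv² : M u v * M u v ≡ 1ℚ
      uv² = sign² (adjacent⇒sign uv)

      M-u≡0 : ∀ {t} → t ∈ T → t ≢ v → M u t ≡ 0ℚ
      M-u≡0 t∈T t≢v = nonadjacent⇒0 λ ut → t≢v (pendant-neighbour deg v∈T uv t∈T ut)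

    extend : Vector ℚ n → Vector ℚ n
    extend x i = x i + a x * unit u i

    extend-≢ : ∀ x {i} → i ≢ u → extend x i ≡ x i
    extend-≢ x {i} i≢u = begin
      x i + a x * unit u i  ≡⟨ cong (λ e → x i + a x * e) (unit-≢ (i≢u ∘ sym)) ⟩
      x i + a x * 0ℚ        ≡⟨ solve 2 (λ p q → p :+ q :* con 0ℚ := p) refl (x i) (a x) ⟩
      x i                   ∎

    private
      sum-extend : ∀ x t → sum (λ i → extend x i * M i t) ≡ sum (λ i → x i * M i t) + a x * M u t
      sum-extend x t = begin
        sum (λ i → extend x i * M i t)
          ≡⟨ sum-cong-≗ (λ i → solve 4 (λ p q r s → (p :+ q :* r) :* s := p :* s :+ q :* (r :* s)) refl
               (x i) (a x) (unit u i) (M i t)) ⟩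
        sum (λ i → x i * M i t + a x * (unit u i * M i t))
          ≡⟨ ∑-distrib-+ (λ i → x i * M i t) _ ⟩
        sum (λ i → x i * M i t) + sum (λ i → a x * (unit u i * M i t))
          ≡⟨ cong (sum (λ i → x i * M i t) +_)
               (sym (*-distribˡ-sum (a x) (λ i → unit u i * M i t))) ⟩
        sum (λ i → x i * M i t) + a x * sum (λ i → unit u i * M i t)
          ≡⟨ cong (λ s → sum (λ i → x i * M i t) + a x * s) (sum-unit u (λ i → M i t)) ⟩
        sum (λ i → x i * M i t) + a x * M u t ∎

      vanish : ∀ {x t} → sum (λ i → x i * M i t) ≡ 0ℚ → M u t ≡ 0ℚ →
               sum (λ i → x i * M i t) + a x * M u t ≡ 0ℚ
      vanish {x} p q = trans (cong₂ (λ y z → y + a x * z) p q)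
        (solve 1 (λ y → con 0ℚ :+ y :* con 0ℚ := con 0ℚ) refl (a x))

    extend-null : ∀ {x} → NullOn T′ x → NullOn T (extend x)
    extend-null {x} nx .support i∉T =
      trans (extend-≢ x λ { refl → i∉T u∈T }) (support nx (i∉T ∘ T′⊆T))
    extend-null {x} nx .null {t} t∈T = trans (sum-extend x t) (vanishes (t ≟ v) (t ≟ u))
      where
      vanishes : Dec (t ≡ v) → Dec (t ≡ u) → sum (λ i → x i * M i t) + a x * M u t ≡ 0ℚ
      vanishes (yes refl) _ = begin
        S + - (S * M u v) * M u v  ≡⟨ solve 2 (λ s m → s :+ :- (s :* m) :* m := s :+ :- s :* (m :* m)) refl S (M u v) ⟩
        S + - S * (M u v * M u v)  ≡⟨ cong (λ m → S + - S * m) uv² ⟩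
        S + - S * 1ℚ               ≡⟨ solve 1 (λ s → s :+ :- s :* con 1ℚ := con 0ℚ) refl S ⟩
        0ℚ                         ∎
        where S = sum (λ i → x i * M i v)
      -- At `u`: its only neighbour in `T` is `v`, where `x` is zero.
      vanishes (no t≢v) (yes refl) = vanish {x} (sum-zero _ term) (M-u≡0 u∈T t≢v)
        where
        term : ∀ i → x i * M i u ≡ 0ℚ
        term i with i ∈? T′
        ... | no i∉T′ = trans (cong (_* M i u) (support nx i∉T′)) (*-zeroˡ (M i u))
        ... | yes i∈T′ = trans (cong (x i *_) (nonadjacent⇒0 λ iu →
                v∉T′ (subst (_∈ T′)
                  (pendant-neighbour deg v∈T uv (T′⊆T i∈T′) (adjacent-sym iu)) i∈T′)))
                (*-zeroʳ (x i))
      -- Elsewhere `t` lies in `T′` and is not adjacent to `u`, so the equation is the one already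
      -- satisfied by `x`.
      vanishes (no t≢v) (no t≢u) =
        vanish {x} (null nx (x∈p∧x≢y⇒x∈p-y (x∈p∧x≢y⇒x∈p-y t∈T t≢u) t≢v)) (M-u≡0 t∈T t≢v)

    -- Extension changes only the coordinate `u`, where the original vectors all vanish. A relation
    -- among the extensions is therefore a relation among the originals.
    extend-family : ∀ {d} → NullFamily T′ d → NullFamily T d
    extend-family F = record
      { family      = extend ∘ family F
      ; nullOn      = extend-null ∘ nullOn F
      ; independent = λ c h → independent F c λ t → unextend c h t (t ≟ u)
      }
      where
      unextend : ∀ c → (∀ t → sum (λ j → c j * extend (family F j) t) ≡ 0ℚ) →
                 ∀ t → Dec (t ≡ u) → sum (λ j → c j * family F j t) ≡ 0ℚ
      unextend c h t (yes refl) = sum-zero _ λ j →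
        trans (cong (c j *_) (support (nullOn F j) u∉T′)) (*-zeroʳ (c j))
      unextend c h t (no t≢u) =
        trans (sum-cong-≗ λ j → cong (c j *_) (sym (extend-≢ (family F j) t≢u))) (h t)

  δ*-nullFamily : ∀ {T T′ d} → Star (δ G) T T′ → NullFamily T′ d → NullFamily T d
  δ*-nullFamily ε F = F
  δ*-nullFamily ((u , v , u∈T , deg , v∈T , uv , refl) ◅ steps) F =
    extend-family u∈T deg v∈T uv (δ*-nullFamily steps F)

  -- Pulled back to `⊤`, the equations hold at every vertex, so the family consists of genuine left
  -- null vectors of `M`.
  sr-nullFamily : ∀ {T d} → Star (δ G) ⊤ T → NullFamily T d → sr G ≤ n ∸ d
  sr-nullFamily steps F = rank+leftNull≤ M (family F⊤) (λ j t → null (nullOn F⊤ j) ∈⊤) (independent F⊤)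
    where F⊤ = δ*-nullFamily steps F

  []-null : ∀ {T} → NullFamily T 0
  []-null = record
    { family = λ () ; nullOn = λ () ; independent = λ _ _ () }

  ∷-null : ∀ {T d x} → NullOn T x → (F : NullFamily T d) → ∀ p →
           x p ≢ 0ℚ → (∀ j → family F j p ≡ 0ℚ) → NullFamily T (suc d)
  ∷-null {x = x} nx F p xp≢0 Fp≡0 = record
    { family      = x ∷ᶠ family F
    ; nullOn      = λ { zero → nx ; (suc j) → nullOn F j }
    ; independent = independent-∷ x (family F) p xp≢0 Fp≡0 (independent F)
    }

  unit-null : ∀ {T w} → w ∈ T → (∀ {t} → t ∈ T → ¬ Adjacent G w t) → NullOn T (unit w)
  unit-null {w = w} w∈T isolated .support {i} i∉T = unit-≢ {w = w} {t = i} λ { refl → i∉T w∈T }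
  unit-null {w = w} w∈T isolated .null {t} t∈T =
    trans (sum-unit w (λ i → M i t)) (nonadjacent⇒0 (isolated t∈T))

-- Periodic functions and the cyclic successor

module _ {A : Set} {k : ℕ} (g : ℕ → A) (periodic : ∀ m → g (m ℕ.+ suc k) ≡ g m) where

  periodic-multiple : ∀ q m → g (m ℕ.+ q ℕ.* suc k) ≡ g m
  periodic-multiple zero    m = cong g (ℕ.+-identityʳ m)
  periodic-multiple (suc q) m = begin
    g (m ℕ.+ (suc k ℕ.+ q ℕ.* suc k))  ≡⟨ cong g (ℕ.+-assoc m (suc k) _) ⟨
    g (m ℕ.+ suc k ℕ.+ q ℕ.* suc k)    ≡⟨ periodic-multiple q (m ℕ.+ suc k) ⟩
    g (m ℕ.+ suc k)                    ≡⟨ periodic m ⟩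
    g m                                ∎

  -- Permits arithmetic on unreduced natural indices in place of modular arithmetic on `Fin`.
  periodic-mod : ∀ m → g (toℕ (m mod suc k)) ≡ g m
  periodic-mod m = begin
    g (toℕ (m mod suc k))                       ≡⟨ cong g (toℕ-fromℕ< (m%n<n m (suc k))) ⟩
    g (m % suc k)                               ≡⟨ periodic-multiple (m / suc k) (m % suc k) ⟨
    g (m % suc k ℕ.+ m / suc k ℕ.* suc k)       ≡⟨ cong g (m≡m%n+[m/n]*n m (suc k)) ⟨
    g m                                         ∎

mod-periodic : ∀ {k} m → (m ℕ.+ suc k) mod suc k ≡ m mod suc k
mod-periodic {k} m = fromℕ<-cong _ _ ([m+n]%n≡m%n m (suc k)) _ _

mod-toℕ : ∀ {k} (i : Fin (suc k)) → toℕ i mod suc k ≡ i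
mod-toℕ i = toℕ-injective (trans (toℕ-fromℕ< _) (m<n⇒m%n≡m (toℕ<n i)))

-- Adding `k` is subtracting one modulo `suc k`, without truncated subtraction.
prev : ∀ {k} → Fin (suc k) → Fin (suc k)
prev {k} i = (toℕ i ℕ.+ k) mod suc k

next-prev : ∀ {k} (i : Fin (suc k)) → next (prev i) ≡ i
next-prev {k} i = begin
  suc (toℕ (prev i)) mod suc k       ≡⟨ periodic-mod (λ m → suc m mod suc k) (mod-periodic ∘ suc) (toℕ i ℕ.+ k) ⟩
  suc (toℕ i ℕ.+ k) mod suc k        ≡⟨ cong (_mod suc k) (ℕ.+-suc (toℕ i) k) ⟨
  (toℕ i ℕ.+ suc k) mod suc k        ≡⟨ mod-periodic (toℕ i) ⟩
  toℕ i mod suc k                    ≡⟨ mod-toℕ i ⟩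
  i                                  ∎

prev-next : ∀ {k} (i : Fin (suc k)) → prev (next i) ≡ i
prev-next {k} i = begin
  (toℕ (next i) ℕ.+ k) mod suc k     ≡⟨ periodic-mod (λ m → (m ℕ.+ k) mod suc k) shift (suc (toℕ i)) ⟩
  (suc (toℕ i) ℕ.+ k) mod suc k      ≡⟨ cong (_mod suc k) (ℕ.+-suc (toℕ i) k) ⟨
  (toℕ i ℕ.+ suc k) mod suc k        ≡⟨ mod-periodic (toℕ i) ⟩
  toℕ i mod suc k                    ≡⟨ mod-toℕ i ⟩
  i                                  ∎
  where
  shift : ∀ m → (m ℕ.+ suc k ℕ.+ k) mod suc k ≡ (m ℕ.+ k) mod suc k
  shift m = trans (cong (_mod suc k) (trans (ℕ.+-assoc m (suc k) k)
    (trans (cong (m ℕ.+_) (ℕ.+-comm (suc k) k)) (sym (ℕ.+-assoc m k (suc k))))))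
    (mod-periodic (m ℕ.+ k))

next-injective : ∀ {k} {i j : Fin (suc k)} → next i ≡ next j → i ≡ j
next-injective {i = i} {j} eq = trans (sym (prev-next i)) (trans (cong prev eq) (prev-next j))

next² : ∀ {k} (i : Fin (suc k)) → next (next i) ≡ (2 ℕ.+ toℕ i) mod suc k
next² {k} i = periodic-mod (λ m → suc m mod suc k) (mod-periodic ∘ suc) (suc (toℕ i))

-- The two neighbours of a cycle vertex are different. Otherwise `2 + a` would leave remainder `a`
-- on division by `suc k`, making 2 a multiple of a number that is at least 3.
next²-≢ : ∀ {k} → 3 ≤ suc k → (i : Fin (suc k)) → i ≢ next (next i)
next²-≢ {k} 3≤k i i≡ = absurd ((2 ℕ.+ a) / suc k) two
  where
  a = toℕ i
  two : 2 ≡ (2 ℕ.+ a) / suc k ℕ.* suc k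
  two = ℕ.+-cancelˡ-≡ a _ _ (begin
    a ℕ.+ 2                       ≡⟨ ℕ.+-comm a 2 ⟩
    2 ℕ.+ a                       ≡⟨ m≡m%n+[m/n]*n (2 ℕ.+ a) (suc k) ⟩
    (2 ℕ.+ a) % suc k ℕ.+ (2 ℕ.+ a) / suc k ℕ.* suc k
      ≡⟨ cong (ℕ._+ (2 ℕ.+ a) / suc k ℕ.* suc k)
           (trans (cong toℕ (trans i≡ (next² i))) (toℕ-fromℕ< (m%n<n (2 ℕ.+ a) (suc k)))) ⟨
    a ℕ.+ (2 ℕ.+ a) / suc k ℕ.* suc k ∎)
  absurd : ∀ q → 2 ≢ q ℕ.* suc k
  absurd zero ()
  absurd (suc q) eq = ℕ.<-irrefl eq (ℕ.≤-trans 3≤k (ℕ.m≤m+n (suc k) (q ℕ.* suc k)))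

-- Alternating sequences and partial products

alt : ℚ → ℚ → ℕ → ℚ
alt a b zero    = a
alt a b (suc m) = alt b a m

alt-even : ∀ {a b} q m → alt a b (q ℕ.* 2 ℕ.+ m) ≡ alt a b m
alt-even zero    m = refl
alt-even (suc q) m = alt-even q m

alt-scale : ∀ a b s m → alt a b m * s ≡ alt (a * s) (b * s) m
alt-scale a b s zero    = refl
alt-scale a b s (suc m) = alt-scale b a s m

odd⇒1+2q : ∀ {m} → 2 ∤ m → ∃ λ q → m ≡ suc (q ℕ.* 2)
odd⇒1+2q {m} 2∤m with m % 2 | m%n<n m 2 | m≡m%n+[m/n]*n m 2
... | 0 | _ | eq = contradiction (divides (m / 2) eq) 2∤m
... | 1 | _ | eq = m / 2 , eq
... | suc (suc _) | s≤s (s≤s ()) | _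

partialProduct : (ℕ → ℚ) → ℕ → ℚ
partialProduct s zero    = 1ℚ
partialProduct s (suc m) = partialProduct s m * s m

-- `partialProduct` grows at the right end, whereas the `foldr` of `cycleSign` peels factors off the
-- left.
partialProduct-suc : ∀ s m → partialProduct s (suc m) ≡ s 0 * partialProduct (s ∘ suc) m
partialProduct-suc s zero    = *-comm 1ℚ (s 0)
partialProduct-suc s (suc m) = trans (cong (_* s (suc m)) (partialProduct-suc s m)) (*-assoc (s 0) _ _)

foldr-partialProduct : ∀ {m} (s : ℕ → ℚ) (f : Vector ℚ m) → (∀ i → f i ≡ s (toℕ i)) →
                       foldr _*_ 1ℚ f ≡ partialProduct s m
foldr-partialProduct {zero}  s f eq = refl
foldr-partialProduct {suc m} s f eq = trans
  (cong₂ _*_ (eq zero) (foldr-partialProduct (s ∘ suc) (f ∘ suc) (eq ∘ suc)))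
  (sym (partialProduct-suc s m))

partialProduct-sign : ∀ {s} → (∀ m → IsSign (s m)) → ∀ m → IsSign (partialProduct s m)
partialProduct-sign sign zero    = inj₁ refl
partialProduct-sign sign (suc m) = sign-* (partialProduct-sign sign m) (sign m)

-- Null vectors supported on the cycle

module _ {n k : ℕ} {G : OrientedGraph n} (C : Cycle G (suc k)) where
  open Cycle C
  open NullOn
  open NullFamily

  private
    M : Matrix n n
    M = skewAdjacency G

    edge : Vector ℚ (suc k)
    edge i = M (vertex i) (vertex (next i))

    -- Edge signs along the unrolled cycle, indexed by all natural numbers.
    s : ℕ → ℚ
    s m = edge (m mod suc k)

    s-periodic : ∀ m → s (m ℕ.+ suc k) ≡ s m
    s-periodic m = cong edge (mod-periodic m)

    s-toℕ : ∀ i → s (toℕ i) ≡ edge i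
    s-toℕ i = cong edge (mod-toℕ i)

    s-sign : ∀ m → IsSign (s m)
    s-sign m = adjacent⇒sign G (adjacent (m mod suc k))

    P : ℕ → ℚ
    P = partialProduct s

    σ : ℚ
    σ = P (suc k)

    σ-sign : IsSign σ
    σ-sign = partialProduct-sign s-sign (suc k)

    cycleSign≡σ : cycleSign C ≡ σ
    cycleSign≡σ = foldr-partialProduct s edge (sym ∘ s-toℕ)

    -- A further full turn multiplies in every edge sign once, hence contributes `σ`.
    P-shift : ∀ m → P (m ℕ.+ suc k) ≡ P m * σ
    P-shift zero    = sym (*-identityˡ σ)
    P-shift (suc m) = begin
      P (m ℕ.+ suc k) * s (m ℕ.+ suc k)  ≡⟨ cong₂ _*_ (P-shift m) (s-periodic m) ⟩
      P m * σ * s m                      ≡⟨ solve 3 (λ p q r → p :* q :* r := p :* r :* q) refl (P m) σ (s m) ⟩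
      P m * s m * σ                      ∎

    -- The null equation at the vertex m + 1 of the cycle reads
    -- s m · x m = s (m + 1) · x (m + 2).
    weight : ℚ → ℚ → ℕ → ℚ
    weight a b m = alt a b m * P m

    -- The equation links positions two apart, over which `alt` repeats while `P` gains the factors
    -- `s m` and `s (suc m)`. The latter squares to one.
    weight-step : ∀ a b m → weight a b m * s m ≡ weight a b (2 ℕ.+ m) * s (suc m)
    weight-step a b m = begin
      A * p * s₀                    ≡⟨ *-identityʳ _ ⟨
      A * p * s₀ * 1ℚ               ≡⟨ cong (A * p * s₀ *_) (sign² (s-sign (suc m))) ⟨
      A * p * s₀ * (s₁ * s₁)        ≡⟨ solve 4 (λ a p x y → a :* p :* x :* (y :* y) := a :* (p :* x :* y) :* y)
                                        refl A p s₀ s₁ ⟩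
      A * (p * s₀ * s₁) * s₁        ∎
      where
      A = alt a b m
      p = P m
      s₀ = s m
      s₁ = s (suc m)

    -- The closing condition: weights computed along the unrolled cycle descend to its vertices.
    Consistent : ℚ → ℚ → Set
    Consistent a b = ∀ m → weight a b (m ℕ.+ suc k) ≡ weight a b m

    -- A turn of odd length swaps the two parameters and multiplies by `σ`. The pair `1ℚ`, `σ` is
    -- invariant under this because `σ` squares to one.
    consistent-odd : 2 ∤ suc k → Consistent 1ℚ σ
    consistent-odd odd m with odd⇒1+2q odd
    ... | q , eq = begin
      alt 1ℚ σ (m ℕ.+ suc k) * P (m ℕ.+ suc k)
        ≡⟨ cong₂ _*_ (trans (cong (alt 1ℚ σ) (trans (ℕ.+-comm m (suc k)) (cong (ℕ._+ m) eq)))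
                            (alt-even q m))
                     (P-shift m) ⟩
      alt σ 1ℚ m * (P m * σ)      ≡⟨ solve 3 (λ a p x → a :* (p :* x) := a :* x :* p) refl (alt σ 1ℚ m) (P m) σ ⟩
      alt σ 1ℚ m * σ * P m        ≡⟨ cong (_* P m) (alt-scale σ 1ℚ σ m) ⟩
      alt (σ * σ) (1ℚ * σ) m * P m
        ≡⟨ cong₂ (λ a b → alt a b m * P m) (sign² σ-sign) (*-identityˡ σ) ⟩
      alt 1ℚ σ m * P m            ∎

    -- A turn of even length keeps the alternation in phase and multiplies by `σ`, which is one.
    -- Both parameters stay free, whence two null vectors.
    consistent-even : ∀ {a b} → 2 ∣ suc k → σ ≡ 1ℚ → Consistent a b
    consistent-even {a} {b} (divides q eq) σ≡1 m = cong₂ _*_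
      (trans (cong (alt a b) (trans (ℕ.+-comm m (suc k)) (cong (ℕ._+ m) eq))) (alt-even q m))
      (trans (P-shift m) (trans (cong (P m *_) σ≡1) (*-identityʳ (P m))))

  OffCycle : Fin n → Set
  OffCycle w = ∀ i → vertex i ≢ w

  spread : (ℕ → ℚ) → Vector ℚ n
  spread x w with any? (λ i → vertex i ≟ w)
  ... | yes (i , _) = x (toℕ i)
  ... | no  _       = 0ℚ

  spread-vertex : ∀ x i → spread x (vertex i) ≡ x (toℕ i)
  spread-vertex x i with any? (λ j → vertex j ≟ vertex i)
  ... | yes (j , eq) = cong (x ∘ toℕ) (injective eq)
  ... | no  ¬on      = contradiction (i , refl) ¬on

  spread-off : ∀ x {w} → OffCycle w → spread x w ≡ 0ℚ
  spread-off x {w} off with any? (λ j → vertex j ≟ w)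
  ... | yes (j , eq) = contradiction eq (off j)
  ... | no  _        = refl

  module _ {T : Subset n} (isol : CycleWithIsolatedVertices G C T) where
    private
      vertex∈T : ∀ i → vertex i ∈ T
      vertex∈T = proj₁ isol

      -- Vertices outside `T` are off the cycle, where `spread x` vanishes; inside `T` every edge is
      -- a cycle edge.
      term-zero : ∀ x {i t} → t ∈ T → (i ∈ T → ¬ CycleEdge C i t) → spread x i * M i t ≡ 0ℚ
      term-zero x {i} {t} t∈T ¬edge with i ∈? T
      ... | yes i∈T = trans (cong (spread x i *_) (nonadjacent⇒0 G λ it → ¬edge i∈T (proj₂ isol i∈T t∈T it)))
                            (*-zeroʳ (spread x i))
      ... | no  i∉T = trans (cong (_* M i t) (spread-off x λ { j refl → i∉T (vertex∈T j) }))
                            (*-zeroˡ (M i t))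

      -- Only the two cycle neighbours of `vertex (next p)` contribute. By skew-symmetry the second
      -- enters with a minus sign, so `step` makes them cancel.
      spread-at : ∀ {x} → (∀ m → x (m ℕ.+ suc k) ≡ x m) →
                  (∀ m → x m * s m ≡ x (2 ℕ.+ m) * s (suc m)) →
                  ∀ p → sum (λ i → spread x i * M i (vertex (next p))) ≡ 0ℚ
      spread-at {x} periodic step p = begin
        sum f
          ≡⟨ sum-pair (next²-≢ 3≤k p ∘ injective) f zero-off ⟩
        f (vertex p) + f (vertex (next (next p)))
          ≡⟨ cong₂ _+_ left right ⟩
        x (toℕ p) * s (toℕ p) + - (x (2 ℕ.+ toℕ p) * s (suc (toℕ p)))
          ≡⟨ cong (λ y → y + - (x (2 ℕ.+ toℕ p) * s (suc (toℕ p)))) (step (toℕ p)) ⟩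
        x (2 ℕ.+ toℕ p) * s (suc (toℕ p)) + - (x (2 ℕ.+ toℕ p) * s (suc (toℕ p)))
          ≡⟨ solve 1 (λ y → y :+ :- y := con 0ℚ) refl (x (2 ℕ.+ toℕ p) * s (suc (toℕ p))) ⟩
        0ℚ ∎
        where
        f : Vector ℚ n
        f i = spread x i * M i (vertex (next p))

        zero-off : ∀ t → t ≢ vertex p → t ≢ vertex (next (next p)) → f t ≡ 0ℚ
        zero-off t t≢p t≢q = term-zero x (vertex∈T (next p)) λ where
          _ (l , inj₁ (t≡ , eq)) →
            t≢p (trans t≡ (cong vertex (next-injective (injective (sym eq)))))
          _ (l , inj₂ (eq , t≡)) →
            t≢q (trans t≡ (cong (vertex ∘ next) (injective (sym eq))))

        left : f (vertex p) ≡ x (toℕ p) * s (toℕ p)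
        left = cong₂ _*_ (spread-vertex x p) (sym (s-toℕ p))

        x-q : spread x (vertex (next (next p))) ≡ x (2 ℕ.+ toℕ p)
        x-q = begin
          spread x (vertex (next (next p)))  ≡⟨ spread-vertex x (next (next p)) ⟩
          x (toℕ (next (next p)))            ≡⟨ cong (x ∘ toℕ) (next² p) ⟩
          x (toℕ ((2 ℕ.+ toℕ p) mod suc k))  ≡⟨ periodic-mod x periodic (2 ℕ.+ toℕ p) ⟩
          x (2 ℕ.+ toℕ p)                    ∎

        right : f (vertex (next (next p))) ≡ - (x (2 ℕ.+ toℕ p) * s (suc (toℕ p)))
        right = begin
          spread x (vertex (next (next p))) * M (vertex (next (next p))) (vertex (next p))
            ≡⟨ cong₂ _*_ x-q (skew G (vertex (next p)) (vertex (next (next p)))) ⟩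
          x (2 ℕ.+ toℕ p) * - edge (next p)
            ≡⟨ solve 2 (λ y z → y :* :- z := :- (y :* z)) refl (x (2 ℕ.+ toℕ p)) (edge (next p)) ⟩
          - (x (2 ℕ.+ toℕ p) * s (suc (toℕ p))) ∎

    spread-null : ∀ {x} → (∀ m → x (m ℕ.+ suc k) ≡ x m) →
                  (∀ m → x m * s m ≡ x (2 ℕ.+ m) * s (suc m)) → NullOn G T (spread x)
    spread-null {x} periodic step .support i∉T = spread-off x λ { j refl → i∉T (vertex∈T j) }
    spread-null {x} periodic step .null {t} t∈T with any? (λ j → vertex j ≟ t)
    -- Every cycle vertex is the successor of its predecessor, so `spread-at` reaches it.
    ... | yes (j , refl) = subst (λ j → sum (λ i → spread x i * M i (vertex j)) ≡ 0ℚ)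
                             (next-prev j) (spread-at periodic step (prev j))
    -- Cycle edges have both ends on the cycle, so no term survives at a vertex off it.
    ... | no ¬on = sum-zero (λ i → spread x i * M i t) λ i → term-zero x {i} t∈T λ where
        _ (l , inj₁ (_ , eq)) → ¬on (next l , sym eq)
        _ (l , inj₂ (eq , _)) → ¬on (l , sym eq)

    private
      weight-null : ∀ {a b} → Consistent a b → NullOn G T (spread (weight a b))
      weight-null {a} {b} consistent = spread-null consistent (weight-step a b)

    -- The weight at position zero is 1, so the vector is nonzero. Vanishing off the cycle is
    -- recorded so that unit vectors of isolated vertices can be adjoined.
    odd-nullFamily : 2 ∤ suc k →
      Σ[ F ∈ NullFamily G T 1 ] (∀ {w} → OffCycle w → ∀ j → family F j w ≡ 0ℚ)
    odd-nullFamily odd =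
      ∷-null G (weight-null (consistent-odd odd)) ([]-null G) (vertex zero)
        (λ eq → contradiction (trans (sym (spread-vertex (weight 1ℚ σ) zero)) eq) λ ()) (λ ())
      , λ { off zero → spread-off (weight 1ℚ σ) off }

    -- The parameters `1ℚ`, `0ℚ` and `0ℚ`, `1ℚ` give vectors separated at `vertex zero`, where only
    -- the first is nonzero; the second is nonzero at the next vertex.
    even-nullFamily : EvenlyOriented C →
      Σ[ F ∈ NullFamily G T 2 ] (∀ {w} → OffCycle w → ∀ j → family F j w ≡ 0ℚ)
    even-nullFamily (even , positive) =
      ∷-null G (weight-null (consistent 1ℚ 0ℚ))
        (∷-null G (weight-null (consistent 0ℚ 1ℚ)) ([]-null G) (vertex (next zero)) at-1 (λ ()))
        (vertex zero) at-0 (λ { zero → spread-vertex (weight 0ℚ 1ℚ) zero })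
      , λ { off zero → spread-off (weight 1ℚ 0ℚ) off ; off (suc zero) → spread-off (weight 0ℚ 1ℚ) off }
      where
      consistent : ∀ a b → Consistent a b
      consistent a b = consistent-even even
        (sign-positive σ-sign (subst (0ℚ ℚ.<_) cycleSign≡σ positive))

      at-0 : spread (weight 1ℚ 0ℚ) (vertex zero) ≢ 0ℚ
      at-0 eq = contradiction (trans (sym (spread-vertex (weight 1ℚ 0ℚ) zero)) eq) λ ()

      at-1 : spread (weight 0ℚ 1ℚ) (vertex (next zero)) ≢ 0ℚ
      at-1 eq = sign-≢0 (sign-* (inj₁ refl) (partialProduct-sign s-sign 1)) (begin
        weight 0ℚ 1ℚ 1                                   ≡⟨ periodic-mod (weight 0ℚ 1ℚ) (consistent 0ℚ 1ℚ) 1 ⟨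
        weight 0ℚ 1ℚ (toℕ (next {suc k} zero))           ≡⟨ spread-vertex (weight 0ℚ 1ℚ) (next zero) ⟨
        spread (weight 0ℚ 1ℚ) (vertex (next zero))       ≡⟨ eq ⟩
        0ℚ                                               ∎)

    -- Edges within `T` lie on the cycle, so `w` has no neighbour in `T`. Coordinate `w` separates
    -- its unit vector from the family.
    isolated-∷ : ∀ {w d} → w ∈ T → OffCycle w →
      Σ[ F ∈ NullFamily G T d ] (∀ {w} → OffCycle w → ∀ j → family F j w ≡ 0ℚ) →
      NullFamily G T (suc d)
    isolated-∷ {w} w∈T off (F , F-off) = ∷-null G (unit-null G w∈T isolated) F w
      (λ eq → contradiction (trans (sym (unit-self w)) eq) λ ()) (F-off off)
      where
      isolated : ∀ {t} → t ∈ T → ¬ Adjacent G w t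
      isolated t∈T wt with proj₂ isol w∈T t∈T wt
      ... | l , inj₁ (w≡ , _) = off l (sym w≡)
      ... | l , inj₂ (_ , w≡) = off (next l) (sym w≡)

-- Counting null vectors by parity

theorem5p1 : ∀ {n k : ℕ} (G : OrientedGraph n) →
    Connected G → Unicyclic G → HasGirth G k → k < n →
    (C : Cycle G k) →
    (𝒰₁ G k →
    (2 ∣ n → sr G ≤ n) ×
    (2 ∤ n → sr G ≤ n ∸ 1)) ×
    (𝒰₂ G C →
    (2 ∤ n → 2 ∤ k → sr G ≤ n ∸ 1) ×
    (2 ∣ n → 2 ∤ k → sr G ≤ n ∸ 2) ×
    (2 ∣ n → OddlyOriented C → sr G ≤ n) ×
    (2 ∤ n → OddlyOriented C → sr G ≤ n ∸ 1) ×
    (2 ∣ n → EvenlyOriented C → sr G ≤ n ∸ 2) ×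
    (2 ∤ n → EvenlyOriented C → sr G ≤ n ∸ 3))
theorem5p1 {k = zero} G _ _ _ _ C with () ← Cycle.3≤k C
theorem5p1 {n} {suc k} G _ _ _ _ C = part₁ , part₂
  where
  full : sr G ≤ n
  -- The trivial bound: no transformation and no null vectors.
  full = sr-nullFamily G ε ([]-null G)

  module _ {T : Subset n} (steps : Star (δ G) ⊤ T) where
    even-n⇒even-T : 2 ∣ n → 2 ∣ ∣ T ∣
    even-n⇒even-T = Equivalence.to (δ*-even G steps) ∘ subst (2 ∣_) (sym (∣⊤∣≡n n))

    even-T⇒even-n : 2 ∣ ∣ T ∣ → 2 ∣ n
    even-T⇒even-n = subst (2 ∣_) (∣⊤∣≡n n) ∘ Equivalence.from (δ*-even G steps)

  part₁ : 𝒰₁ G (suc k) → (2 ∣ n → sr G ≤ n) × (2 ∤ n → sr G ≤ n ∸ 1)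
  part₁ (_ , _ , T , steps , edgeless) = (λ _ → full) , odd
    where
    odd : 2 ∤ n → sr G ≤ n ∸ 1
    -- The map from `Fin 0` misses a vertex of `T` unless `T` is empty, which would make `n` even.
    odd 2∤n with missed {m = 0} T (λ ()) (λ {i} → contradiction i λ ()) (λ ())
                   (λ ∣T∣≡0 → 2∤n (even-T⇒even-n steps (subst (2 ∣_) (sym ∣T∣≡0) (2 ∣0))))
    ... | w , w∈T , _ = sr-nullFamily G steps
      (∷-null G (unit-null G w∈T (edgeless w∈T)) ([]-null G) w
        (λ eq → contradiction (trans (sym (unit-self w)) eq) λ ()) (λ ()))

  part₂ : 𝒰₂ G C → _
  part₂ (_ , _ , T , steps , isol) =
      (λ _ odd-k → sr-nullFamily G steps (proj₁ (odd-nullFamily C isol odd-k)))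
    -- The size of `T` is even and the cycle is odd, so an isolated vertex adds one vector to that
    -- of the cycle.
    , (λ even-n odd-k → with-isolated (λ eq → odd-k (subst (2 ∣_) eq (even-n⇒even-T steps even-n)))
                          (odd-nullFamily C isol odd-k))
    , (λ _ _ → full)
    -- No vector is taken from an oddly-oriented cycle; the single one comes from an isolated
    -- vertex.
    , (λ odd-n (even-k , _) → with-isolated (odd-even odd-n even-k) ([]-null G , λ _ ()))
    , (λ _ evenly → sr-nullFamily G steps (proj₁ (even-nullFamily C isol evenly)))
    -- Two vectors from the cycle and one from an isolated vertex.
    , (λ odd-n evenly → with-isolated (odd-even odd-n (proj₁ evenly)) (even-nullFamily C isol evenly))
    where
    odd-even : 2 ∤ n → 2 ∣ suc k → ∣ T ∣ ≢ suc k
    odd-even odd-n even-k eq = odd-n (even-T⇒even-n steps (subst (2 ∣_) (sym eq) even-k))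

    with-isolated : ∀ {d} → ∣ T ∣ ≢ suc k →
      Σ[ F ∈ NullFamily G T d ] (∀ {w} → OffCycle C w → ∀ j → NullFamily.family F j w ≡ 0ℚ) →
      sr G ≤ n ∸ suc d
    with-isolated ∣T∣≢k F
      with w , w∈T , off ← missed T (Cycle.vertex C) (Cycle.injective C) (proj₁ isol) ∣T∣≢k
      = sr-nullFamily G steps (isolated-∷ C isol w∈T off F)
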